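{- Let $M$ be an $n\times n$ matrix over a commutative ring and let $k$ be an integer with $1\le k\le n$. Then for each $j$ with $1\le j\le k$, $$\det(M)\det(M_{[k],[k]})=\sum_{i=1}^k(-1)^{i+j}\det(M_{\{i\},\{j\}})\det(M_{[k]\setminus\{i\},[k]\setminus\{j\}}).$$
   Context: $[k]=\{1,2,\dots,k\}$. For sets $U,W$ of indices with $|U|=|W|$, $M_{U,W}$ denotes the submatrix of $M$ obtained by removing the rows indexed by $U$ and the columns indexed by $W$. The determinant of the empty ($0\times 0$) matrix is $1$. -}

module Defs where

open import Algebra.Bundles using (CommutativeRing)
import Algebra.Properties.CommutativeMonoid.Sum as MonoidSum
import Algebra.Properties.Semiring.Exp as SemiringExp
import Algebra.Properties.Semiring.Sum as SemiringSum
open import Data.Bool.Base using (if_then_else_)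
open import Data.Fin.Base using (Fin; zero; suc; toℕ; cast; inject≤)
import Data.Fin.Base as Fin
open import Data.Fin.Permutation using (Permutation′; _⟨$⟩ʳ_; id; insert)
open import Data.Fin.Properties using (toℕ<n; toℕ-inject≤)
import Data.Fin.Properties as Fin
open import Data.Fin.Subset using (Subset; inside; outside; ∁; ⁅_⁆; _∈_; _-_; ∣_∣)
open import Data.Fin.Subset.Properties using (∣⁅x⁆∣≡1; ∣∁p∣≡n∸∣p∣; p─⊥≡p)
open import Data.List.Base using (List; []; _∷_; foldr; allFin; cartesianProductWith)
open import Data.Nat.Base using (ℕ; zero; suc; _≤_; _<_; _∸_)
open import Data.Nat.Properties using (_<?_; +-0-commutativeMonoid; suc-injective)
open import Data.Vec.Base using ([]; _∷_; tabulate; here; there)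
open import Data.Vec.Functional using (Vector)
open import Data.Vec.Properties using (lookup∘tabulate; lookup⇒[]=)
open import Relation.Binary.PropositionalEquality
  using (_≡_; refl; sym; trans; cong; subst; module ≡-Reasoning)
open import Relation.Nullary.Decidable using (does; dec-true; _×-dec_)

private
  variable
    n : ℕ

-- Indices are 0-based: the index i ∈ {1, …, n} of the mathematical text is the
-- element of Fin n whose value is i − 1.  Signs (-1)^{i+j} are unaffected.

-- The set {1, …, k} of indices, as a subset of the n indices available.
[_] : ℕ → Subset n
[ k ] = tabulate (λ i → does (toℕ i <? k))

-- The increasing enumeration of the elements of a subset.
enumerate : (p : Subset n) → Fin ∣ p ∣ → Fin n
enumerate (inside  ∷ p) zero    = zero
enumerate (inside  ∷ p) (suc i) = suc (enumerate p i)
enumerate (outside ∷ p) i       = suc (enumerate p i)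

∣∁∣-cong : (U W : Subset n) → ∣ U ∣ ≡ ∣ W ∣ → ∣ ∁ U ∣ ≡ ∣ ∁ W ∣
∣∁∣-cong {n} U W eq = begin
  ∣ ∁ U ∣    ≡⟨ ∣∁p∣≡n∸∣p∣ U ⟩
  n ∸ ∣ U ∣  ≡⟨ cong (n ∸_) eq ⟩
  n ∸ ∣ W ∣  ≡⟨ ∣∁p∣≡n∸∣p∣ W ⟨
  ∣ ∁ W ∣    ∎
  where open ≡-Reasoning

∣⁅⁆∣-cong : (i j : Fin n) → ∣ ⁅ i ⁆ ∣ ≡ ∣ ⁅ j ⁆ ∣
∣⁅⁆∣-cong i j = trans (∣⁅x⁆∣≡1 i) (sym (∣⁅x⁆∣≡1 j))

suc∣p-x∣≡∣p∣ : {p : Subset n} {x : Fin n} → x ∈ p → suc ∣ p - x ∣ ≡ ∣ p ∣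
suc∣p-x∣≡∣p∣ {p = inside  ∷ p} here      = cong (λ q → suc ∣ q ∣) (p─⊥≡p p)
suc∣p-x∣≡∣p∣ {p = inside  ∷ p} (there h) = cong suc (suc∣p-x∣≡∣p∣ h)
suc∣p-x∣≡∣p∣ {p = outside ∷ p} (there h) = suc∣p-x∣≡∣p∣ h

inject≤∈[k] : {k : ℕ} (i : Fin k) (k≤n : k ≤ n) → inject≤ i k≤n ∈ [ k ]
inject≤∈[k] {k = k} i k≤n = lookup⇒[]= (inject≤ i k≤n) [ k ] (trans
  (lookup∘tabulate (λ l → does (toℕ l <? k)) (inject≤ i k≤n))
  (dec-true (toℕ (inject≤ i k≤n) <? k)
    (subst (_< k) (sym (toℕ-inject≤ i k≤n)) (toℕ<n i))))

∣[k]-∣-cong : {k : ℕ} (i j : Fin k) (k≤n : k ≤ n) →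
              ∣ [ k ] - inject≤ i k≤n ∣ ≡ ∣ [ k ] - inject≤ j k≤n ∣
∣[k]-∣-cong i j k≤n = suc-injective (trans
  (suc∣p-x∣≡∣p∣ (inject≤∈[k] i k≤n))
  (sym (suc∣p-x∣≡∣p∣ (inject≤∈[k] j k≤n))))

-- All permutations of Fin n, each exactly once up to pointwise equality:
-- π ↦ (π 0 , remove 0 π) is inverse to (j , π) ↦ insert 0 j π, the permutation
-- sending 0 to j and otherwise arranged like π.
permutations : ∀ n → List (Permutation′ n)
permutations zero    = id ∷ []
permutations (suc n) = cartesianProductWith (insert zero) (allFin (suc n)) (permutations n)

inversions : Permutation′ n → ℕ
inversions {n} σ = ∑[ a < n ] ∑[ b < n ]
  (if does ((a Fin.<? b) ×-dec ((σ ⟨$⟩ʳ b) Fin.<? (σ ⟨$⟩ʳ a))) then 1 else 0)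
  where open MonoidSum +-0-commutativeMonoid using (sum-syntax)

module Determinant {c ℓ} (R : CommutativeRing c ℓ) where

  open CommutativeRing R using (Carrier; _+_; _*_; -_; 0#; 1#; semiring; *-commutativeMonoid)
  open MonoidSum *-commutativeMonoid using () renaming (sum to product)
  open SemiringSum semiring public using (sum-syntax)

  SquareMatrix : ℕ → Set c
  SquareMatrix n = Vector (Vector Carrier n) n

  infix 9 -1^_

  -1^_ : ℕ → Carrier
  -1^ m = (- 1#) ^ m
    where open SemiringExp semiring using (_^_)

  det : SquareMatrix n → Carrier
  det {n} M = foldr (λ σ s → -1^ (inversions σ) * product (λ i → M i (σ ⟨$⟩ʳ i)) + s)
                    0# (permutations n)

  -- The submatrix obtained by removing the rows in U and the columns in W.  Its
  -- row and column counts ∣ ∁ U ∣ and ∣ ∁ W ∣ are only propositionally equal,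
  -- hence the cast.
  remove : (U W : Subset n) → .(∣ U ∣ ≡ ∣ W ∣) → SquareMatrix n → SquareMatrix ∣ ∁ U ∣
  remove U W eq M r s =
    M (enumerate (∁ U) r) (enumerate (∁ W) (cast (∣∁∣-cong U W eq) s))

{-# OPTIONS --safe #-}
module Submission where

-- Write T for the complement of [k] and, for every row r, let B r be the matrix
-- with rows r, T and columns j, T of M.  Expanding along its first row,
-- det (B r) = Σ_c g c * M r c with c ranging over the columns j, T, where the
-- coefficients g do not depend on r and g j = det (M_{[k],[k]}).  Pairing with the
-- cofactors of column j of M kills every column c ∈ T, hence
--   Σ_r (-1)^{r+j} det (M_{{r},{j}}) det (B r) = det (M_{[k],[k]}) det M.
-- The terms with r ∈ T vanish because B r has a repeated row, and for r = i ∈ [k]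
-- the matrix B i is M_{[k]∖{i},[k]∖{j}}.

open import Algebra.Bundles using (CommutativeRing)
import Algebra.Properties.CommutativeMonoid.Sum as MonoidSum
open import Data.Bool.Base using (if_then_else_; _∧_)
open import Data.Fin.Base using (Fin; zero; suc; toℕ; cast; inject≤; punchIn; punchOut)
import Data.Fin.Base as Fin
open import Data.Fin.Permutation using (Permutation′; _⟨$⟩ʳ_; insert)
open import Data.Fin.Properties using (_≟_; punchInᵢ≢i; punchIn-punchOut)
import Data.Fin.Properties as Fin
open import Data.Fin.Subset using (Subset; inside; outside; ⊥; ∁; ⁅_⁆; _∈_; _-_; ∣_∣)
open import Data.Fin.Subset.Properties using (p─⊥≡p; ∣⁅x⁆∣≡1; ∣∁p∣≡n∸∣p∣)
open import Data.List.Base using (List; []; _∷_; _++_; foldr; map; tabulate; allFin; cartesianProductWith)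
open import Data.Nat.Base as ℕ using (ℕ; zero; suc; _≤_; z≤n; s≤s)
open import Data.Nat.Properties using (+-0-commutativeMonoid)
import Data.Nat.Properties as ℕ
open import Data.Product.Base using (∃-syntax; _×_; _,_)
open import Data.Vec.Base using (here; there) renaming (_∷_ to _∷ᵛ_)
open import Data.Vec.Functional using (Vector) renaming (_∷_ to _∷ᶠ_)
open import Function.Base using (_∘_; flip; id)
open import Level using (Level)
open import Relation.Binary.PropositionalEquality
  using (_≡_; _≢_; refl; sym; trans; cong; cong₂)
open import Relation.Nullary.Decidable using (does; yes; no)
open import Relation.Nullary.Negation using (contradiction)
open import Defs

-- Inversions of an inserted permutation.

module _ where

  open MonoidSum +-0-commutativeMonoid

  punchIn-<? : ∀ {n} (j : Fin (suc n)) (x y : Fin n) →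
               does (punchIn j x Fin.<? punchIn j y) ≡ does (x Fin.<? y)
  punchIn-<? zero    x       y       = refl
  punchIn-<? (suc j) zero    zero    = refl
  punchIn-<? (suc j) zero    (suc y) = refl
  punchIn-<? (suc j) (suc x) zero    = refl
  punchIn-<? (suc j) (suc x) (suc y) = punchIn-<? j x y

  count-punchIn-< : ∀ {n} (j : Fin (suc n)) →
    (∑[ b < n ] (if does (punchIn j b Fin.<? j) then 1 else 0)) ≡ toℕ j
  count-punchIn-< {n}     zero    = sum-replicate-zero n
  count-punchIn-< {suc n} (suc j) = cong suc (count-punchIn-< j)

  -- The pairs `(zero , suc b)` are inversions exactly when `punchIn j (π b)` lies below `j`;
  -- reindexing by `π` leaves the count of all values below `j`. On the remaining pairs `punchIn j`
  -- preserves and reflects the order, so the inversions are those of `π`.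
  inversions-insert : ∀ {n} (j : Fin (suc n)) (π : Permutation′ n) →
                      inversions (insert zero j π) ≡ toℕ j ℕ.+ inversions π
  inversions-insert {n} j π = cong₂ ℕ._+_
    (trans
      (sym (sum-permute (λ b → if does (punchIn j b Fin.<? j) then 1 else 0) π))
      (count-punchIn-< j))
    (sum-cong-≗ λ a → sum-cong-≗ λ b →
      cong (λ t → if does (a Fin.<? b) ∧ t then 1 else 0)
           (punchIn-<? j (π ⟨$⟩ʳ b) (π ⟨$⟩ʳ a)))

-- Deleting or avoiding two indices.

-- Both sides enumerate increasingly the indices other than `c` and `e`. This identifies the double
-- minors obtained by deleting two columns in either order.
punchIn-punchOut-comm : ∀ {n} {c e : Fin (suc (suc n))} (p : c ≢ e) (q : e ≢ c) (s : Fin n) →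
  punchIn c (punchIn (punchOut p) s) ≡ punchIn e (punchIn (punchOut q) s)
punchIn-punchOut-comm {c = zero}  {zero}  p q s = contradiction refl p
punchIn-punchOut-comm {c = zero}  {suc e} p q s = refl
punchIn-punchOut-comm {c = suc c} {zero}  p q s = refl
punchIn-punchOut-comm {c = suc c} {suc e} p q zero    = refl
punchIn-punchOut-comm {c = suc c} {suc e} p q (suc s) =
  cong suc (punchIn-punchOut-comm (p ∘ cong suc) (q ∘ cong suc) s)

-- Supplies the row of expansion for a matrix whose rows `a` and `b` are equal.
avoidTwo : ∀ {n} (a b : Fin (suc (suc (suc n)))) → ∃[ r ] r ≢ a × r ≢ b
avoidTwo zero          zero          = suc zero , (λ ()) , (λ ())
avoidTwo zero          (suc zero)    = suc (suc zero) , (λ ()) , (λ ())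
avoidTwo zero          (suc (suc b)) = suc zero , (λ ()) , (λ ())
avoidTwo (suc zero)    zero          = suc (suc zero) , (λ ()) , (λ ())
avoidTwo (suc (suc a)) zero          = suc zero , (λ ()) , (λ ())
avoidTwo (suc a)       (suc b)       = zero , (λ ()) , (λ ())

-- Increasing enumerations of complements.

enumerate-∁⊥ : ∀ {n} (r : Fin ∣ ∁ (⊥ {n}) ∣) .(eq : ∣ ∁ (⊥ {n}) ∣ ≡ n) → enumerate (∁ ⊥) r ≡ cast eq r
enumerate-∁⊥ {suc n} zero    eq = refl
enumerate-∁⊥ {suc n} (suc r) eq = cong suc (enumerate-∁⊥ r (ℕ.suc-injective eq))

enumerate-∁⁅⁆ : ∀ {n} (i : Fin (suc n)) (r : Fin ∣ ∁ ⁅ i ⁆ ∣) .(eq : ∣ ∁ ⁅ i ⁆ ∣ ≡ n) →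
                enumerate (∁ ⁅ i ⁆) r ≡ punchIn i (cast eq r)
enumerate-∁⁅⁆         zero    r       eq = cong suc (enumerate-∁⊥ r eq)
enumerate-∁⁅⁆ {suc n} (suc i) zero    eq = refl
enumerate-∁⁅⁆ {suc n} (suc i) (suc r) eq = cong suc (enumerate-∁⁅⁆ i r (ℕ.suc-injective eq))

enumerate-cong : ∀ {n} {p q : Subset n} → p ≡ q → (r : Fin ∣ p ∣) .(eq : ∣ p ∣ ≡ ∣ q ∣) →
                 enumerate p r ≡ enumerate q (cast eq r)
enumerate-cong {p = p} refl r eq = cong (enumerate p) (sym (Fin.cast-is-id eq r))

suc-∷ : ∀ {m n} (x : Fin n) (f : Fin m → Fin n) r →
        suc ((x ∷ᶠ f) r) ≡ (suc x ∷ᶠ (suc ∘ f)) r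
suc-∷ x f zero    = refl
suc-∷ x f (suc r) = refl

-- The complement gains the single element `inject≤ i k≤n`. It belongs to `[ k ]`, hence is smaller
-- than every element of `∁ [ k ]` and comes first in the enumeration.
enumerate-∁[k]-ι : ∀ {n k} (k≤n : k ≤ n) (i : Fin k)
  (r : Fin ∣ ∁ ([ k ] - inject≤ i k≤n) ∣) .(eq : ∣ ∁ ([ k ] - inject≤ i k≤n) ∣ ≡ suc ∣ ∁ ([_] {n} k) ∣) →
  enumerate (∁ ([ k ] - inject≤ i k≤n)) r ≡ (inject≤ i k≤n ∷ᶠ enumerate (∁ [ k ])) (cast eq r)
enumerate-∁[k]-ι (s≤s k≤n) zero zero    eq = refl
enumerate-∁[k]-ι (s≤s {m = k} k≤n) zero (suc r) eq =
  cong suc (enumerate-cong (cong ∁ (p─⊥≡p [ k ])) r (ℕ.suc-injective eq))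
enumerate-∁[k]-ι (s≤s {m = k} k≤n) (suc i) r eq =
  trans (cong suc (enumerate-∁[k]-ι k≤n i r eq)) (suc-∷ (inject≤ i k≤n) (enumerate (∁ [ k ])) (cast eq r))

inject≤≢enumerate-∁[k] : ∀ {n k} (k≤n : k ≤ n) (i : Fin k) (s : Fin ∣ ∁ ([_] {n} k) ∣) →
                         inject≤ i k≤n ≢ enumerate (∁ [ k ]) s
inject≤≢enumerate-∁[k] (s≤s k≤n) zero    s = λ ()
inject≤≢enumerate-∁[k] (s≤s k≤n) (suc i) s = inject≤≢enumerate-∁[k] k≤n i s ∘ Fin.suc-injective

∣∁⁅⁆∣ : ∀ {n} (i : Fin (suc n)) → ∣ ∁ ⁅ i ⁆ ∣ ≡ n
∣∁⁅⁆∣ {n} i = trans (∣∁p∣≡n∸∣p∣ ⁅ i ⁆) (cong (suc n ℕ.∸_) (∣⁅x⁆∣≡1 i))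

∣∁[p-x]∣≡suc∣∁p∣ : ∀ {n} {p : Subset n} {x : Fin n} → x ∈ p → ∣ ∁ (p - x) ∣ ≡ suc ∣ ∁ p ∣
∣∁[p-x]∣≡suc∣∁p∣ {p = inside  ∷ᵛ p} here      = cong (λ q → suc ∣ ∁ q ∣) (p─⊥≡p p)
∣∁[p-x]∣≡suc∣∁p∣ {p = inside  ∷ᵛ p} (there h) = ∣∁[p-x]∣≡suc∣∁p∣ h
∣∁[p-x]∣≡suc∣∁p∣ {p = outside ∷ᵛ p} (there h) = cong suc (∣∁[p-x]∣≡suc∣∁p∣ h)

module _ {c ℓ} (R : CommutativeRing c ℓ) where

  private
    module R = CommutativeRing R
  open R hiding (refl; sym; trans; zero; _-_)
  open Determinant R
  open import Algebra.Properties.Semiring.Exp semiring using (^-homo-*; ^-congʳ)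
  open import Algebra.Properties.Semiring.Sum semiring using (*-distribˡ-sum)
  open MonoidSum +-commutativeMonoid
    using (sum; sum-cong-≋; sum-replicate-zero; ∑-distrib-+; ∑-comm)
  open import Algebra.Properties.Ring ring using (-‿involutive; -1*x≈-x)
  open import Algebra.Solver.CommutativeMonoid *-commutativeMonoid using (solve; _⊕_; _⊜_)
  open import Algebra.Properties.CommutativeMonoid.Sum *-commutativeMonoid
    using () renaming (sum to product; sum-cong-≋ to product-cong)
  open import Relation.Binary.Reasoning.Setoid setoid

  private
    variable
      m n : ℕ

  -- Sums over finite index sets and lists.

  sum-zero : {f : Vector Carrier n} → (∀ i → f i ≈ 0#) → sum f ≈ 0#
  sum-zero {n} f≈0 = R.trans (sum-cong-≋ f≈0) (sum-replicate-zero n)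

  -- The same fold as in `det`, so that `det M` is a `listSum` by definition.
  listSum : ∀ {a} {A : Set a} → (A → Carrier) → List A → Carrier
  listSum f = foldr (λ x s → f x + s) 0#

  module _ {a} {A : Set a} where

    listSum-cong : {f g : A → Carrier} → (∀ x → f x ≈ g x) → ∀ xs → listSum f xs ≈ listSum g xs
    listSum-cong f≈g []       = R.refl
    listSum-cong f≈g (x ∷ xs) = +-cong (f≈g x) (listSum-cong f≈g xs)

    listSum-++ : (f : A → Carrier) → ∀ xs ys → listSum f (xs ++ ys) ≈ listSum f xs + listSum f ys
    listSum-++ f []       ys = R.sym (+-identityˡ _)
    listSum-++ f (x ∷ xs) ys = R.trans (+-congˡ (listSum-++ f xs ys)) (R.sym (+-assoc _ _ _))

    *-distribˡ-listSum : ∀ t (f : A → Carrier) xs → t * listSum f xs ≈ listSum (λ x → t * f x) xs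
    *-distribˡ-listSum t f []       = zeroʳ t
    *-distribˡ-listSum t f (x ∷ xs) = R.trans (distribˡ t _ _) (+-congˡ (*-distribˡ-listSum t f xs))

    listSum-map : ∀ {b} {B : Set b} (f : A → Carrier) (g : B → A) xs →
                  listSum f (map g xs) ≈ listSum (f ∘ g) xs
    listSum-map f g []       = R.refl
    listSum-map f g (x ∷ xs) = +-congˡ (listSum-map f g xs)

    listSum-tabulate : (f : A → Carrier) (g : Fin n → A) → listSum f (tabulate g) ≈ sum (f ∘ g)
    listSum-tabulate {zero}  f g = R.refl
    listSum-tabulate {suc n} f g = +-congˡ (listSum-tabulate f (g ∘ suc))

    listSum-cartesianProductWith :
      ∀ {b d} {B : Set b} {D : Set d} (f : A → Carrier) (g : B → D → A) xs ys →
      listSum f (cartesianProductWith g xs ys) ≈ listSum (λ x → listSum (λ y → f (g x y)) ys) xs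
    listSum-cartesianProductWith f g []       ys = R.refl
    listSum-cartesianProductWith f g (x ∷ xs) ys = R.trans
      (listSum-++ f (map (g x) ys) _)
      (+-cong (listSum-map f (g x) ys) (listSum-cartesianProductWith f g xs ys))

  -- Signs.

  -1^-+ : ∀ a b → -1^ (a ℕ.+ b) ≈ -1^ a * -1^ b
  -1^-+ = ^-homo-* (- 1#)

  -1*-1≈1 : - 1# * - 1# ≈ 1#
  -1*-1≈1 = R.trans (-1*x≈-x (- 1#)) (-‿involutive 1#)

  -- Deleting the smaller of the two indices lowers the position of the larger by one, while
  -- deleting the larger leaves the smaller in place. The two exponents therefore differ by exactly
  -- one.
  -1^-punchOut : ∀ {n} {c e : Fin (suc n)} (p : c ≢ e) (q : e ≢ c) →
    -1^ toℕ c * -1^ toℕ (punchOut p) ≈ - 1# * (-1^ toℕ e * -1^ toℕ (punchOut q))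
  -1^-punchOut {c = zero}  {zero}  p q = contradiction refl p
  -1^-punchOut {suc n} {c = zero}  {suc e} p q = begin
    1# * -1^ toℕ e                        ≈⟨ *-congʳ -1*-1≈1 ⟨
    - 1# * - 1# * -1^ toℕ e               ≈⟨ *-assoc _ _ _ ⟩
    - 1# * (- 1# * -1^ toℕ e)             ≈⟨ *-congˡ (*-identityʳ _) ⟨
    - 1# * (- 1# * -1^ toℕ e * 1#)        ∎
  -1^-punchOut {suc n} {c = suc c} {zero}  p q = R.trans (*-identityʳ _) (*-congˡ (R.sym (*-identityˡ _)))
  -1^-punchOut {suc n} {c = suc c} {suc e} p q = begin
    (- 1# * -1^ toℕ c) * (- 1# * -1^ toℕ (punchOut p′))
      ≈⟨ solve 3 (λ x y z → ((x ⊕ y) ⊕ (x ⊕ z)) ⊜ (x ⊕ (x ⊕ (y ⊕ z)))) R.refl (- 1#) _ _ ⟩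
    - 1# * (- 1# * (-1^ toℕ c * -1^ toℕ (punchOut p′)))
      ≈⟨ *-congˡ (*-congˡ (-1^-punchOut p′ q′)) ⟩
    - 1# * (- 1# * (- 1# * (-1^ toℕ e * -1^ toℕ (punchOut q′))))
      ≈⟨ *-congˡ (solve 3 (λ x y z → (x ⊕ (x ⊕ (y ⊕ z))) ⊜ ((x ⊕ y) ⊕ (x ⊕ z))) R.refl (- 1#) _ _) ⟩
    - 1# * ((- 1# * -1^ toℕ e) * (- 1# * -1^ toℕ (punchOut q′)))  ∎
    where
    p′ = p ∘ cong suc
    q′ = q ∘ cong suc

  -- Minors and Laplace expansion along a row.

  infix 4 _≋_
  _≋_ : (M N : SquareMatrix n) → Set ℓ
  M ≋ N = ∀ r s → M r s ≈ N r s

  minor : Fin (suc n) → Fin (suc n) → SquareMatrix (suc n) → SquareMatrix n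
  minor r s M i j = M (punchIn r i) (punchIn s j)

  transpose : SquareMatrix n → SquareMatrix n
  transpose = flip

  det-cong : {M N : SquareMatrix n} → M ≋ N → det M ≈ det N
  det-cong {n} M≋N = listSum-cong
    (λ σ → *-congˡ (product-cong (λ i → M≋N i (σ ⟨$⟩ʳ i)))) (permutations n)

  -- Compares matrices whose sizes agree only propositionally, as happens for `remove`; once `eq` is
  -- `refl` both casts are identities.
  det-cong-cast : (eq : m ≡ n) (M : SquareMatrix m) (N : SquareMatrix n) →
                  (∀ r s → M r s ≈ N (cast eq r) (cast eq s)) → det M ≈ det N
  det-cong-cast refl M N h = det-cong λ r s →
    R.trans (h r s) (reflexive (cong₂ N (Fin.cast-is-id refl r) (Fin.cast-is-id refl s)))

  laplaceTerm : Fin (suc n) → SquareMatrix (suc n) → Vector Carrier (suc n)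
  laplaceTerm r M c = -1^ (toℕ r ℕ.+ toℕ c) * M r c * det (minor r c M)

  -- The list `permutations (suc n)` is already grouped by the image `c` of `zero`. Within a group,
  -- `inversions-insert` splits off the sign `-1^ toℕ c` and leaves the Leibniz sum of the minor.
  det-expand₀ : (M : SquareMatrix (suc n)) → det M ≈ sum (laplaceTerm zero M)
  det-expand₀ {n} M = begin
    det M
      ≈⟨ listSum-cartesianProductWith term (insert zero) (allFin (suc n)) (permutations n) ⟩
    listSum (λ c → listSum (λ π → term (insert zero c π)) (permutations n)) (allFin (suc n))
      ≈⟨ listSum-tabulate {n = suc n}
           (λ c → listSum (λ π → term (insert zero c π)) (permutations n)) id ⟩
    ∑[ c < suc n ] listSum (λ π → term (insert zero c π)) (permutations n)
      ≈⟨ sum-cong-≋ (λ c → R.trans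
           (listSum-cong (term-insert c) (permutations n))
           (R.sym (*-distribˡ-listSum _ _ (permutations n)))) ⟩
    ∑[ c < suc n ] (-1^ toℕ c * M zero c * det (minor zero c M))
      ∎
    where
    term : Permutation′ (suc n) → Carrier
    term σ = -1^ (inversions σ) * product (λ i → M i (σ ⟨$⟩ʳ i))

    term-insert : ∀ c π → term (insert zero c π) ≈
      -1^ toℕ c * M zero c * (-1^ (inversions π) * product (λ i → minor zero c M i (π ⟨$⟩ʳ i)))
    term-insert c π = begin
      -1^ (inversions (insert zero c π)) * (M zero c * p)
        ≈⟨ *-congʳ (^-congʳ (- 1#) (inversions-insert c π)) ⟩
      -1^ (toℕ c ℕ.+ inversions π) * (M zero c * p)
        ≈⟨ *-congʳ (-1^-+ (toℕ c) (inversions π)) ⟩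
      -1^ toℕ c * -1^ (inversions π) * (M zero c * p)
        ≈⟨ solve 4 (λ a b x y → ((a ⊕ b) ⊕ (x ⊕ y)) ⊜ ((a ⊕ x) ⊕ (b ⊕ y))) R.refl _ _ _ _ ⟩
      -1^ toℕ c * M zero c * (-1^ (inversions π) * p)
        ∎
      where p = product (λ i → minor zero c M i (π ⟨$⟩ʳ i))

  -- Both sides run over the ordered pairs (c , e) of distinct indices, once
  -- sorted by c and once sorted by e.
  ∑-comm-offDiagonal : (f g : Fin (suc n) → Fin n → Carrier) →
    (∀ c e (p : c ≢ e) (q : e ≢ c) → f c (punchOut p) ≈ g e (punchOut q)) →
    ∑[ c < suc n ] ∑[ d < n ] f c d ≈ ∑[ e < suc n ] ∑[ d < n ] g e d
  ∑-comm-offDiagonal {zero}  f g f≈g = R.refl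
  ∑-comm-offDiagonal {suc n} f g f≈g = begin
    sum (f zero) + ∑[ c < suc n ] (f (suc c) zero + ∑[ d < n ] f (suc c) (suc d))
      ≈⟨ +-cong (sum-cong-≋ (λ d → f≈g zero (suc d) (λ ()) (λ ())))
                (∑-distrib-+ (λ c → f (suc c) zero) (λ c → ∑[ d < n ] f (suc c) (suc d))) ⟩
    ∑[ e < suc n ] g (suc e) zero +
      (∑[ c < suc n ] f (suc c) zero + ∑[ c < suc n ] ∑[ d < n ] f (suc c) (suc d))
      ≈⟨ +-congˡ (+-cong (sum-cong-≋ (λ d → f≈g (suc d) zero (λ ()) (λ ())))
           (∑-comm-offDiagonal (λ c d → f (suc c) (suc d)) (λ c d → g (suc c) (suc d))
              λ c e p q → f≈g (suc c) (suc e) (p ∘ Fin.suc-injective) (q ∘ Fin.suc-injective))) ⟩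
    ∑[ e < suc n ] g (suc e) zero + (sum (g zero) + ∑[ e < suc n ] ∑[ d < n ] g (suc e) (suc d))
      ≈⟨ +-assoc _ _ _ ⟨
    (∑[ e < suc n ] g (suc e) zero + sum (g zero)) + ∑[ e < suc n ] ∑[ d < n ] g (suc e) (suc d)
      ≈⟨ +-congʳ (+-comm _ _) ⟩
    (sum (g zero) + ∑[ e < suc n ] g (suc e) zero) + ∑[ e < suc n ] ∑[ d < n ] g (suc e) (suc d)
      ≈⟨ +-assoc _ _ _ ⟩
    sum (g zero) + (∑[ e < suc n ] g (suc e) zero + ∑[ e < suc n ] ∑[ d < n ] g (suc e) (suc d))
      ≈⟨ +-congˡ (∑-distrib-+ (λ e → g (suc e) zero) (λ e → ∑[ d < n ] g (suc e) (suc d))) ⟨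
    sum (g zero) + ∑[ e < suc n ] (g (suc e) zero + ∑[ d < n ] g (suc e) (suc d))
      ∎

  -- Induction on the row: expand along row `zero`, then each minor along row `r`. The terms are
  -- indexed by ordered pairs of distinct columns, and resorting them by the second column gives the
  -- expansion along `suc r`, with its minors expanded along row `zero`.
  det-expandRow : (r : Fin (suc n)) (M : SquareMatrix (suc n)) →
    det M ≈ sum (laplaceTerm r M)
  det-expandRow zero M = det-expand₀ M
  det-expandRow {suc n} (suc r) M = begin
    det M
      ≈⟨ det-expand₀ M ⟩
    ∑[ c < 2+n ] (-1^ toℕ c * M zero c * det (minor zero c M))
      ≈⟨ sum-cong-≋ (λ c → R.trans (*-congˡ (det-expandRow r (minor zero c M)))
           (*-distribˡ-sum (-1^ toℕ c * M zero c) (laplaceTerm r (minor zero c M)))) ⟩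
    ∑[ c < 2+n ] ∑[ d < suc n ] f c d
      ≈⟨ ∑-comm-offDiagonal f g f≈g ⟩
    ∑[ e < 2+n ] ∑[ d < suc n ] g e d
      ≈⟨ sum-cong-≋ (λ e → R.trans (*-congˡ (det-expand₀ (minor (suc r) e M)))
           (*-distribˡ-sum (-1^ (toℕ (suc r) ℕ.+ toℕ e) * M (suc r) e)
             (laplaceTerm zero (minor (suc r) e M)))) ⟨
    ∑[ e < 2+n ] (-1^ (toℕ (suc r) ℕ.+ toℕ e) * M (suc r) e * det (minor (suc r) e M))
      ∎
    where
    2+n = suc (suc n)

    f g : Fin 2+n → Fin (suc n) → Carrier
    f c d = -1^ toℕ c * M zero c *
      (-1^ (toℕ r ℕ.+ toℕ d) * minor zero c M r d * det (minor r d (minor zero c M)))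
    g e d = -1^ (toℕ (suc r) ℕ.+ toℕ e) * M (suc r) e *
      (-1^ toℕ d * minor (suc r) e M zero d * det (minor zero d (minor (suc r) e M)))

    f≈g : ∀ c e (p : c ≢ e) (q : e ≢ c) → f c (punchOut p) ≈ g e (punchOut q)
    f≈g c e p q = begin
      -1^ toℕ c * M zero c * (-1^ (toℕ r ℕ.+ toℕ (punchOut p)) * M (suc r) (punchIn c (punchOut p)) * D)
        ≈⟨ *-congˡ (*-cong (*-cong (-1^-+ (toℕ r) (toℕ (punchOut p)))
                                   (reflexive (cong (M (suc r)) (punchIn-punchOut p))))
             (det-cong λ i s → reflexive (cong (M (suc (punchIn r i))) (punchIn-punchOut-comm p q s)))) ⟩
      -1^ toℕ c * M zero c * (-1^ toℕ r * -1^ toℕ (punchOut p) * M (suc r) e * D′)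
        ≈⟨ solve 6 (λ a b x y z w → ((a ⊕ x) ⊕ (((b ⊕ y) ⊕ z) ⊕ w)) ⊜ ((a ⊕ y) ⊕ (b ⊕ (x ⊕ (z ⊕ w)))))
             R.refl _ _ _ _ _ _ ⟩
      -1^ toℕ c * -1^ toℕ (punchOut p) * (-1^ toℕ r * (M zero c * (M (suc r) e * D′)))
        -- The factor `- 1#` gained by exchanging the two deletions turns `-1^ toℕ r` into the sign
        -- belonging to row `suc r`.
        ≈⟨ *-congʳ (-1^-punchOut p q) ⟩
      - 1# * (-1^ toℕ e * -1^ toℕ (punchOut q)) * (-1^ toℕ r * (M zero c * (M (suc r) e * D′)))
        ≈⟨ solve 7
             (λ n a y b x z w →
               ((n ⊕ (a ⊕ y)) ⊕ (b ⊕ (x ⊕ (z ⊕ w)))) ⊜ (((n ⊕ (b ⊕ a)) ⊕ z) ⊕ ((y ⊕ x) ⊕ w)))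
             R.refl _ _ _ _ _ _ _ ⟩
      - 1# * (-1^ toℕ r * -1^ toℕ e) * M (suc r) e * (-1^ toℕ (punchOut q) * M zero c * D′)
        ≈⟨ *-cong (*-congʳ (*-congˡ (-1^-+ (toℕ r) (toℕ e))))
                  (*-congʳ (*-congˡ (reflexive (cong (M zero) (punchIn-punchOut q))))) ⟨
      g e (punchOut q)
        ∎
      where
      D  = det (minor r (punchOut p) (minor zero c M))
      D′ = det (minor zero (punchOut q) (minor (suc r) e M))

  -- Invariance under transposition.

  -- Apart from the corner term, expand along the first column and then each minor along its first
  -- row, or the other way round. Either way the result is a double sum over a row `suc i` and a
  -- column `suc j`, with the same double minors. These have size `n`, whence the second induction
  -- hypothesis.
  det-transpose-step : ((N : SquareMatrix n) → det (transpose N) ≈ det N) →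
                       ((N : SquareMatrix (suc n)) → det (transpose N) ≈ det N) →
                       (M : SquareMatrix (suc (suc n))) → det (transpose M) ≈ det M
  det-transpose-step {n} ih₀ ih₁ M = begin
    det (transpose M)
      ≈⟨ det-expand₀ (transpose M) ⟩
    sum (laplaceTerm zero (transpose M))
      ≈⟨ +-cong (*-congˡ { -1^ 0 * M zero zero} (ih₁ (minor zero zero M))) (sum-cong-≋ columnTerm) ⟩
    head + ∑[ i < suc n ] ∑[ j < suc n ] f i j
      ≈⟨ +-congˡ (∑-comm f) ⟩
    head + ∑[ j < suc n ] ∑[ i < suc n ] f i j
      ≈⟨ +-congˡ {head} (sum-cong-≋ rowTerm) ⟨
    sum (laplaceTerm zero M)
      ≈⟨ det-expand₀ M ⟨
    det M
      ∎
    where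
    head : Carrier
    head = -1^ 0 * M zero zero * det (minor zero zero M)

    x y : Fin (suc n) → Carrier
    x i = -1^ toℕ (suc i) * M (suc i) zero
    y j = -1^ toℕ (suc j) * M zero (suc j)

    f : Fin (suc n) → Fin (suc n) → Carrier
    f i j = x i * laplaceTerm zero (minor (suc i) zero M) j

    columnTerm : ∀ i → x i * det (transpose (minor (suc i) zero M)) ≈ sum (f i)
    columnTerm i = begin
      x i * det (transpose N)         ≈⟨ *-congˡ (ih₁ N) ⟩
      x i * det N                     ≈⟨ *-congˡ (det-expand₀ N) ⟩
      x i * sum (laplaceTerm zero N)  ≈⟨ *-distribˡ-sum (x i) (laplaceTerm zero N) ⟩
      sum (f i)                       ∎
      where N = minor (suc i) zero M

    rowTerm : ∀ j → y j * det (minor zero (suc j) M) ≈ ∑[ i < suc n ] f i j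
    rowTerm j = begin
      y j * det N
        ≈⟨ *-congˡ (ih₁ N) ⟨
      y j * det (transpose N)
        ≈⟨ *-congˡ (det-expand₀ (transpose N)) ⟩
      y j * sum (laplaceTerm zero (transpose N))
        ≈⟨ *-distribˡ-sum (y j) (laplaceTerm zero (transpose N)) ⟩
      ∑[ i < suc n ] (y j * laplaceTerm zero (transpose N) i)
        -- By computation, `minor i zero N` is `minor zero j (minor (suc i) zero M)`; only the
        -- scalar factors have to be rearranged.
        ≈⟨ sum-cong-≋ (λ i → R.trans
             (*-congˡ (*-congˡ { -1^ toℕ i * M (suc i) zero} (ih₀ (minor i zero N))))
             (solve 6
               (λ s a u b v d → (((s ⊕ b) ⊕ v) ⊕ ((a ⊕ u) ⊕ d)) ⊜ (((s ⊕ a) ⊕ u) ⊕ ((b ⊕ v) ⊕ d)))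
               R.refl (- 1#) (-1^ toℕ i) (M (suc i) zero) (-1^ toℕ j) (M zero (suc j)) (det (minor i zero N)))) ⟩
      ∑[ i < suc n ] f i j
        ∎
      where N = minor zero (suc j) M

  det-transpose : (M : SquareMatrix n) → det (transpose M) ≈ det M
  det-transpose {zero}        M = R.refl
  det-transpose {suc zero}    M = R.refl
  det-transpose {suc (suc n)} M = det-transpose-step (det-transpose {n}) (det-transpose {suc n}) M

  -- Equal rows, and expansion along a column.

  -- In dimension at least three, expanding along a row other than a and b
  -- leaves minors that again have two equal rows.
  det-equalRows : (M : SquareMatrix n) {a b : Fin n} → a ≢ b → (∀ s → M a s ≈ M b s) → det M ≈ 0#
  det-equalRows {suc zero} M {zero} {zero} a≢b _ = contradiction refl a≢b
  det-equalRows {suc (suc zero)} M {zero} {zero} a≢b _ = contradiction refl a≢b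
  det-equalRows {suc (suc zero)} M {suc zero} {suc zero} a≢b _ = contradiction refl a≢b
  det-equalRows {suc (suc zero)} M {suc zero} {zero} _ h = det-equalRows M {zero} {suc zero} (λ ()) (R.sym ∘ h)
  det-equalRows {suc (suc zero)} M {zero} {suc zero} _ h = begin
    det M
      ≈⟨ det-expand₀ M ⟩
    -1^ 0 * M zero zero * det (minor zero zero M) +
      (-1^ 1 * M zero (suc zero) * det (minor zero (suc zero) M) + 0#)
      ≈⟨ +-cong (*-cong (*-identityˡ _) (det₁ (minor zero zero M)))
                (R.trans (+-identityʳ _) (*-cong (*-congʳ (*-identityʳ _)) (det₁ (minor zero (suc zero) M)))) ⟩
    M zero zero * M (suc zero) (suc zero) + - 1# * M zero (suc zero) * M (suc zero) zero
      ≈⟨ +-cong (*-congˡ (R.sym (h (suc zero)))) (*-congˡ (R.sym (h zero))) ⟩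
    M zero zero * M zero (suc zero) + - 1# * M zero (suc zero) * M zero zero
      ≈⟨ +-congˡ (R.trans (*-assoc _ _ _) (R.trans (-1*x≈-x _) (-‿cong (*-comm _ _)))) ⟩
    M zero zero * M zero (suc zero) + - (M zero zero * M zero (suc zero))
      ≈⟨ -‿inverseʳ _ ⟩
    0#
      ∎
    where
    det₁ : (N : SquareMatrix 1) → det N ≈ N zero zero
    det₁ N = R.trans (+-identityʳ _) (R.trans (*-identityˡ _) (*-identityʳ _))
  det-equalRows {suc (suc (suc n))} M {a} {b} a≢b h =
    let r , r≢a , r≢b = avoidTwo a b in
    R.trans (det-expandRow r M) (sum-zero λ c →
    R.trans (*-congˡ { -1^ (toℕ r ℕ.+ toℕ c) * M r c}
      (det-equalRows (minor r c M) {punchOut r≢a} {punchOut r≢b}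
        (a≢b ∘ Fin.punchOut-injective r≢a r≢b)
        λ s → R.trans (reflexive (cong (λ i → M i (punchIn c s)) (punchIn-punchOut r≢a)))
              (R.trans (h (punchIn c s))
                (reflexive (cong (λ i → M i (punchIn c s)) (sym (punchIn-punchOut r≢b)))))))
    (zeroʳ _))

  -- Row expansion of the transpose. The entry `M i j` is moved to the end so that the cofactors of
  -- column `j` can be paired with another column.
  det-expandColumn : (j : Fin (suc n)) (M : SquareMatrix (suc n)) →
    det M ≈ ∑[ i < suc n ] (-1^ (toℕ i ℕ.+ toℕ j) * det (minor i j M) * M i j)
  det-expandColumn {n} j M = begin
    det M              ≈⟨ det-transpose M ⟨
    det (transpose M)  ≈⟨ det-expandRow j (transpose M) ⟩
    ∑[ i < suc n ] (-1^ (toℕ j ℕ.+ toℕ i) * M i j * det (transpose (minor i j M)))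
      ≈⟨ sum-cong-≋ (λ i → R.trans
           (*-cong (*-congʳ (^-congʳ (- 1#) (ℕ.+-comm (toℕ j) (toℕ i)))) (det-transpose (minor i j M)))
           (solve 3 (λ x y z → ((x ⊕ y) ⊕ z) ⊜ ((x ⊕ z) ⊕ y)) R.refl
              (-1^ (toℕ i ℕ.+ toℕ j)) (M i j) (det (minor i j M)))) ⟩
    ∑[ i < suc n ] (-1^ (toℕ i ℕ.+ toℕ j) * det (minor i j M) * M i j)
      ∎

  -- The sum is the expansion along column j of the matrix obtained from M by
  -- overwriting column j with column c.
  det-expandColumn-alien : {j c : Fin (suc n)} → c ≢ j → (M : SquareMatrix (suc n)) →
    ∑[ i < suc n ] (-1^ (toℕ i ℕ.+ toℕ j) * det (minor i j M) * M i c) ≈ 0#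
  det-expandColumn-alien {n} {j} {c} c≢j M = begin
    ∑[ i < suc n ] (-1^ (toℕ i ℕ.+ toℕ j) * det (minor i j M) * M i c)
      ≈⟨ sum-cong-≋ (λ i → *-cong
           (*-congˡ { -1^ (toℕ i ℕ.+ toℕ j)} (det-cong λ r s → reflexive (cong (M (punchIn i r))
              (sym (overwrite-≢ (punchInᵢ≢i j s))))))
           (reflexive (cong (M i) (sym overwrite-≡)))) ⟩
    ∑[ i < suc n ] (-1^ (toℕ i ℕ.+ toℕ j) * det (minor i j N) * N i j)
      ≈⟨ det-expandColumn j N ⟨
    det N
      ≈⟨ det-transpose N ⟨
    det (transpose N)
      ≈⟨ det-equalRows (transpose N) c≢j
           (λ i → reflexive (cong (M i) (trans (overwrite-≢ c≢j) (sym overwrite-≡)))) ⟩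
    0#
      ∎
    where
    overwrite : Fin (suc n) → Fin (suc n)
    overwrite s = if does (s ≟ j) then c else s

    overwrite-≡ : overwrite j ≡ c
    overwrite-≡ with j ≟ j
    ... | yes _  = refl
    ... | no j≢j = contradiction refl j≢j

    overwrite-≢ : ∀ {s} → s ≢ j → overwrite s ≡ s
    overwrite-≢ {s} s≢j with s ≟ j
    ... | yes s≡j = contradiction s≡j s≢j
    ... | no _    = refl

    N : SquareMatrix (suc n)
    N i s = M i (overwrite s)

  -- Restricting a sum to `[ k ]`, and removal of one row and column.

  sum-inject≤ : ∀ {k} (k≤n : k ≤ n) (f : Vector Carrier n) →
    (∀ s → f (enumerate (∁ [ k ]) s) ≈ 0#) → sum f ≈ ∑[ i < k ] f (inject≤ i k≤n)
  sum-inject≤ {zero}  z≤n       f f≈0 = R.refl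
  sum-inject≤ {suc n} z≤n       f f≈0 =
    R.trans (+-cong (f≈0 zero) (sum-inject≤ z≤n (f ∘ suc) (f≈0 ∘ suc))) (+-identityˡ 0#)
  sum-inject≤ {suc n} (s≤s k≤n) f f≈0 = +-congˡ (sum-inject≤ k≤n (f ∘ suc) f≈0)

  det-remove-⁅⁆ : (i j : Fin (suc n)) (M : SquareMatrix (suc n)) →
    det (remove ⁅ i ⁆ ⁅ j ⁆ (∣⁅⁆∣-cong i j) M) ≈ det (minor i j M)
  det-remove-⁅⁆ i j M = det-cong-cast (∣∁⁅⁆∣ i)
    (remove ⁅ i ⁆ ⁅ j ⁆ (∣⁅⁆∣-cong i j) M) (minor i j M) λ r s → reflexive (cong₂ M
    (enumerate-∁⁅⁆ i r (∣∁⁅⁆∣ i))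
    -- The column index already carries the cast built into `remove`; the two casts are fused into
    -- one.
    (trans (enumerate-∁⁅⁆ j (cast _ s) (∣∁⁅⁆∣ j)) (cong (punchIn j) (Fin.cast-trans _ (∣∁⁅⁆∣ j) s))))

  -- Bordered matrices and the determinant identity.

  module _ (M : SquareMatrix (suc n)) {k} (k≤n : k ≤ suc n) where

    private
      ι : Fin k → Fin (suc n)
      ι i = inject≤ i k≤n

      T : Subset (suc n)
      T = ∁ [ k ]

      E : Fin ∣ T ∣ → Fin (suc n)
      E = enumerate T

    -- For `s = ι j` this is the matrix B r. The border always comes first, unsorted and even when
    -- `r` is in `T`, so that only row `zero` depends on `r`.
    bordered : (r s : Fin (suc n)) → SquareMatrix (suc ∣ T ∣)
    bordered r s a b = M ((r ∷ᶠ E) a) ((s ∷ᶠ E) b)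

    det-remove-[k] : ∀ r s → det (remove [ k ] [ k ] refl M) ≈ det (minor zero zero (bordered r s))
    det-remove-[k] r s = det-cong {M = remove [ k ] [ k ] refl M} {minor zero zero (bordered r s)} λ a b →
      reflexive (cong (M (E a) ∘ E) (Fin.cast-is-id refl b))

    -- No sign arises, since `ι i` and `ι j` precede all of `T`: the border is already in increasing
    -- order.
    det-remove-[k]-ι : ∀ i j →
      det (remove ([ k ] - ι i) ([ k ] - ι j) (∣[k]-∣-cong i j k≤n) M) ≈ det (bordered (ι i) (ι j))
    det-remove-[k]-ι i j = det-cong-cast (size i)
      (remove ([ k ] - ι i) ([ k ] - ι j) (∣[k]-∣-cong i j k≤n) M)
      (bordered (ι i) (ι j)) λ r s → reflexive (cong₂ M
      (enumerate-∁[k]-ι k≤n i r (size i))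
      (trans (enumerate-∁[k]-ι k≤n j (cast _ s) (size j)) (cong (ι j ∷ᶠ E) (Fin.cast-trans _ (size j) s))))
      where
      size : ∀ i → ∣ ∁ ([ k ] - ι i) ∣ ≡ suc ∣ T ∣
      size i = ∣∁[p-x]∣≡suc∣∁p∣ (inject≤∈[k] i k≤n)

    det-bordered-E : ∀ t s → det (bordered (E t) s) ≈ 0#
    det-bordered-E t s = det-equalRows (bordered (E t) s) {zero} {suc t} (λ ()) (λ _ → R.refl)

    det*det-remove-[k] : ∀ j →
      det M * det (remove [ k ] [ k ] refl M) ≈
      ∑[ i < k ]
        (-1^ (toℕ i ℕ.+ toℕ j)
          * det (remove ⁅ ι i ⁆ ⁅ ι j ⁆ (∣⁅⁆∣-cong (ι i) (ι j)) M)
          * det (remove ([ k ] - ι i) ([ k ] - ι j) (∣[k]-∣-cong i j k≤n) M))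
    det*det-remove-[k] j = begin
      det M * det (remove [ k ] [ k ] refl M)
        ≈⟨ *-congˡ (det-remove-[k] (ι j) (ι j)) ⟩
      det M * det (minor zero zero (bordered (ι j) (ι j)))
        ≈⟨ R.trans (*-comm _ _) (*-congʳ (R.sym (*-identityˡ _))) ⟩
      g zero * det M
        ≈⟨ +-identityʳ _ ⟨
      g zero * det M + 0#
        -- In the sum below, `c = zero` gives the expansion of `det M` along column `ι j`. Each
        -- `c = suc s` names a column of `T`, different from `ι j`, which the cofactors of column
        -- `ι j` annihilate.
        ≈⟨ +-cong (*-congˡ (R.sym (det-expandColumn (ι j) M)))
                  (sum-zero λ s → R.trans
                    (*-congˡ (det-expandColumn-alien (inject≤≢enumerate-∁[k] k≤n j s ∘ sym) M))
                    (zeroʳ (g (suc s)))) ⟨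
      ∑[ c < size ] (g c * ∑[ r < suc n ] (cofactor r * M r (column c)))
        ≈⟨ sum-cong-≋ (λ c → *-distribˡ-sum (g c) (λ r → cofactor r * M r (column c))) ⟩
      ∑[ c < size ] ∑[ r < suc n ] (g c * (cofactor r * M r (column c)))
        -- With `r` outermost, the inner sum over `c` becomes a first-row expansion of
        -- `bordered r (ι j)`, scaled by `cofactor r`.
        ≈⟨ ∑-comm (λ c r → g c * (cofactor r * M r (column c))) ⟩
      ∑[ r < suc n ] ∑[ c < size ] (g c * (cofactor r * M r (column c)))
        ≈⟨ sum-cong-≋ expand ⟨
      ∑[ r < suc n ] (cofactor r * det (bordered r (ι j)))
        ≈⟨ sum-inject≤ k≤n (λ r → cofactor r * det (bordered r (ι j)))
             (λ t → R.trans (*-congˡ {cofactor (E t)} (det-bordered-E t (ι j))) (zeroʳ (cofactor (E t)))) ⟩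
      ∑[ i < k ] (cofactor (ι i) * det (bordered (ι i) (ι j)))
        ≈⟨ sum-cong-≋ (λ i → *-cong
             (*-cong (^-congʳ (- 1#) (cong₂ ℕ._+_ (Fin.toℕ-inject≤ i k≤n) (Fin.toℕ-inject≤ j k≤n)))
                     (R.sym (det-remove-⁅⁆ (ι i) (ι j) M)))
             (R.sym (det-remove-[k]-ι i j))) ⟩
      _ ∎
      where
      size : ℕ
      size = suc ∣ T ∣

      column : Fin size → Fin (suc n)
      column = ι j ∷ᶠ E

      cofactor : Fin (suc n) → Carrier
      cofactor r = -1^ (toℕ r ℕ.+ toℕ (ι j)) * det (minor r (ι j) M)

      -- minor zero c (bordered r (ι j)) is the same matrix for every r.
      g : Fin size → Carrier
      g c = -1^ toℕ c * det (minor zero c (bordered (ι j) (ι j)))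

      expand : ∀ r → cofactor r * det (bordered r (ι j)) ≈
                     ∑[ c < size ] (g c * (cofactor r * M r (column c)))
      expand r = begin
        cofactor r * det (bordered r (ι j))
          ≈⟨ *-congˡ (det-expand₀ (bordered r (ι j))) ⟩
        cofactor r * sum (laplaceTerm zero (bordered r (ι j)))
          ≈⟨ *-distribˡ-sum (cofactor r) (laplaceTerm zero (bordered r (ι j))) ⟩
        ∑[ c < size ] (cofactor r * laplaceTerm zero (bordered r (ι j)) c)
          ≈⟨ sum-cong-≋ (λ c → solve 4
               (λ x a m d → (x ⊕ ((a ⊕ m) ⊕ d)) ⊜ ((a ⊕ d) ⊕ (x ⊕ m)))
               R.refl (cofactor r) (-1^ toℕ c) (M r (column c)) (det (minor zero c (bordered r (ι j))))) ⟩
        ∑[ c < size ] (g c * (cofactor r * M r (column c)))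
          ∎

theorem2p1p4 : {c ℓ : Level} (R : CommutativeRing c ℓ) →
  let open CommutativeRing R using (_≈_)
      open CommutativeRing R using (_*_)
      open Determinant R
  in
  (n : ℕ) (M : SquareMatrix n) (k : ℕ) (1≤k : 1 ≤ k) (k≤n : k ≤ n) (j : Fin k) →
  let ι : Fin k → Fin n
      ι i = inject≤ i k≤n
  in
  det M * det (remove [ k ] [ k ] refl M)
    ≈ ∑[ i < k ]
        (-1^ (toℕ i ℕ.+ toℕ j)
          * det (remove ⁅ ι i ⁆ ⁅ ι j ⁆ (∣⁅⁆∣-cong (ι i) (ι j)) M)
          * det (remove ([ k ] - ι i) ([ k ] - ι j) (∣[k]-∣-cong i j k≤n) M))
theorem2p1p4 R zero    M _ _   z≤n ()
theorem2p1p4 R (suc n) M k 1≤k k≤n j = det*det-remove-[k] R M k≤n j
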